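{- The variety $\mathbf{M}_1$ of regular pseudocomplemented de Morgan algebras of range $1$ is locally finite.
   Context: A pseudocomplemented de Morgan algebra is $(L;\wedge,\vee,{}^\ast,{}^\prime,0,1)$ with $(L;\wedge,\vee,0,1)$ a bounded distributive lattice, ${}^\ast$ the pseudocomplement and ${}^\prime$ a de Morgan involution. $\mathbf{M}_1$ is the variety of such algebras satisfying $x\wedge x^{\prime\ast\prime}\le y\vee y^\ast$ (regularity) and $(x\wedge x^{\prime\ast})^{\prime\ast}=(x\wedge x^{\prime\ast})^{\prime\ast\prime\ast}$ (range $1$). -}

module Defs where

open import Algebra.Core using (Op₁)
open import Algebra.Definitions using (Congruent₁; Involutive)
open import Algebra.Lattice.Bundles using (DistributiveLattice)
import Algebra.Lattice.Properties.Lattice as LatticeProperties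
open import Data.Fin.Base using (Fin)
open import Data.List.Relation.Unary.Enumerates.Setoid using (IsEnumeration)
open import Data.Nat.Base using (ℕ)
open import Data.Product.Base using (Σ; ∃-syntax)
open import Function.Bundles using (_⇔_)
open import Level using (Level; _⊔_; suc)
open import Relation.Binary.Bundles using (Poset)
open import Relation.Binary.Definitions using (Maximum; Minimum)

record PseudocomplementedDeMorganAlgebra (c ℓ : Level) : Set (suc (c ⊔ ℓ)) where
  infixl 8 _* _′

  field
    distributiveLattice : DistributiveLattice c ℓ

  open DistributiveLattice distributiveLattice public

  -- x ≤ y unfolds to x ≈ x ∧ y.
  open Poset (LatticeProperties.poset lattice) public using (_≤_)

  field
    ⊤ ⊥     : Carrier
    maximum : Maximum _≤_ ⊤
    minimum : Minimum _≤_ ⊥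

    _*               : Op₁ Carrier
    *-cong           : Congruent₁ _≈_ _*
    pseudocomplement : ∀ x y → (x ∧ y ≈ ⊥) ⇔ (y ≤ x *)

    -- The dual De Morgan law, ⊤ ′ ≈ ⊥ and ⊥ ′ ≈ ⊤ are consequences.
    _′           : Op₁ Carrier
    ′-cong       : Congruent₁ _≈_ _′
    ′-involutive : Involutive _≈_ _′
    ′-deMorgan   : ∀ x y → (x ∨ y) ′ ≈ x ′ ∧ y ′

private
  variable
    c ℓ p : Level

module _ (L : PseudocomplementedDeMorganAlgebra c ℓ) where
  open PseudocomplementedDeMorganAlgebra L

  Regular : Set (c ⊔ ℓ)
  Regular = ∀ x y → x ∧ x ′ * ′ ≤ y ∨ y *

  RangeOne : Set (c ⊔ ℓ)
  RangeOne = ∀ x → (x ∧ x ′ *) ′ * ≈ (x ∧ x ′ *) ′ * ′ *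

  -- The underlying set of the subalgebra generated by g₀, …, gₙ₋₁.
  data Generated {n : ℕ} (g : Fin n → Carrier) : Carrier → Set (c ⊔ ℓ) where
    gen  : ∀ i → Generated g (g i)
    ⊤-cl : Generated g ⊤
    ⊥-cl : Generated g ⊥
    ∧-cl : ∀ {x y} → Generated g x → Generated g y → Generated g (x ∧ y)
    ∨-cl : ∀ {x y} → Generated g x → Generated g y → Generated g (x ∨ y)
    *-cl : ∀ {x} → Generated g x → Generated g (x *)
    ′-cl : ∀ {x} → Generated g x → Generated g (x ′)
    resp : ∀ {x y} → x ≈ y → Generated g x → Generated g y

  FinitelyGenerated : Set (c ⊔ ℓ)
  FinitelyGenerated = ∃[ n ] Σ (Fin n → Carrier) λ g → ∀ x → Generated g x

  -- Every element is ≈ to a member of one list.  The list may repeat elements: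
  -- since ≈ need not be decidable, an exact cardinality is not demanded.
  Finite : Set (c ⊔ ℓ)
  Finite = ∃[ xs ] IsEnumeration setoid xs

record M₁ (L : PseudocomplementedDeMorganAlgebra c ℓ) : Set (c ⊔ ℓ) where
  field
    regular  : Regular L
    rangeOne : RangeOne L

LocallyFinite : (PseudocomplementedDeMorganAlgebra c ℓ → Set p) → Set (suc (c ⊔ ℓ) ⊔ p)
LocallyFinite K = ∀ L → K L → FinitelyGenerated L → Finite L

{-# OPTIONS --safe #-}
module Submission where

-- Modulo x * ≈ y *, the algebra L becomes a Boolean algebra on which x * ′ *
-- induces an operator τ.  It turns joins into meets and is symmetric
-- (x ≤ τ y gives y ≤ τ x), and range one says that ¬ x ∧ τ x is central, i.e.
-- that τ is the operator "x holds nowhere else" of the logic of inequality.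
-- Splitting each minterm a of a finite set of generators into a ∧ τ a and
-- a ∧ ¬ τ a gives a partition whose parts p satisfy p ≤ τ p or p ∧ τ p ≈ ⊥, and
-- then the Boolean algebra generated by all p and τ p is closed under τ: on each
-- part its elements agree with a central z, and τ (z ∧ p) ≈ ¬ z ∨ τ p.
-- Applied to the generators g and g ′ of L, this yields a finite set of elements
-- m * such that L is generated as a lattice by the g, g ′, m * and m * ′.

open import Algebra.Bundles using (CommutativeSemigroup)
open import Algebra.Core using (Op₁)
open import Algebra.Definitions using (Congruent₁)
open import Algebra.Lattice.Bundles using (BooleanAlgebra; DistributiveLattice)
import Algebra.Lattice.Properties.BooleanAlgebra as BooleanAlgebraProperties
import Algebra.Lattice.Properties.Lattice as LatticeProperties
open import Algebra.Lattice.Structures.Biased using (isBooleanAlgebraʳ)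
import Algebra.Properties.CommutativeSemigroup as CommutativeSemigroupProperties
open import Algebra.Structures using (IsCommutativeBand)
open import Data.List.Base using (List; []; _∷_; _++_; cartesianProductWith; foldr; map; tabulate)
open import Data.List.Membership.Propositional using (_∈_; find)
open import Data.List.Membership.Propositional.Properties
  using (∈-++⁺ˡ; ∈-++⁺ʳ; ∈-++⁻; ∈-map⁺; ∈-map⁻; ∈-tabulate⁺)
import Data.List.Membership.Setoid as SetoidMembership
import Data.List.Membership.Setoid.Properties as SetoidMembershipₚ
open import Data.List.Relation.Binary.Subset.Propositional using (_⊆_)
open import Data.List.Relation.Unary.Any using (here; there)
open import Data.Product.Base using (_×_; _,_; ∃-syntax; proj₁; proj₂)
open import Data.Sum.Base using (_⊎_; inj₁; inj₂)
open import Defs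
open import Function.Base using (const; _∘_)
open import Function.Bundles using (Equivalence)
open import Level using (Level; _⊔_)
open import Relation.Binary.Definitions using (Maximum; Minimum)
import Relation.Binary.Lattice as Order
open import Relation.Binary.PropositionalEquality.Core using (_≡_)
import Relation.Binary.PropositionalEquality.Core as ≡
import Relation.Binary.Reasoning.Setoid as ≈-Reasoning

private
  variable
    c ℓ : Level

-- Finiteness of finitely generated bounded distributive lattices.

module BoundedSublattice (D : DistributiveLattice c ℓ) where
  open DistributiveLattice D
  open Order.Lattice (LatticeProperties.∨-∧-orderTheoreticLattice lattice)
    using (_≤_; x≤x∨y; antisym; ∨-least)
  open LatticeProperties lattice using (∧-idem; ∧-isSemilattice; ∨-isSemilattice)
  open ≈-Reasoning setoid
  open SetoidMembership setoid using () renaming (_∈_ to _∈ₛ_)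

  private
    ∧-commutativeSemigroup : CommutativeSemigroup c ℓ
    ∧-commutativeSemigroup = record
      { isCommutativeSemigroup = IsCommutativeBand.isCommutativeSemigroup ∧-isSemilattice }

    ∨-commutativeSemigroup : CommutativeSemigroup c ℓ
    ∨-commutativeSemigroup = record
      { isCommutativeSemigroup = IsCommutativeBand.isCommutativeSemigroup ∨-isSemilattice }

    module ∧-CS = CommutativeSemigroupProperties ∧-commutativeSemigroup
    module ∨-CS = CommutativeSemigroupProperties ∨-commutativeSemigroup

  ∨-affine : ∀ g a b x y → (a ∨ (g ∧ b)) ∨ (x ∨ (g ∧ y)) ≈ (a ∨ x) ∨ (g ∧ (b ∨ y))
  ∨-affine g a b x y = trans (∨-CS.interchange _ _ _ _) (∨-congˡ (sym (∧-distribˡ-∨ g b y)))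

  -- Elements `a ∨ (g ∧ b)` act as affine polynomials in `g`. Idempotence of `g` keeps their
  -- products affine: in a meet with `g`, the factor `x ∨ (g ∧ y)` may be replaced by `x ∨ y`.
  ∧-affine : ∀ g a b x y →
             (a ∨ (g ∧ b)) ∧ (x ∨ (g ∧ y)) ≈ (a ∧ x) ∨ (g ∧ ((a ∧ y) ∨ (b ∧ (x ∨ y))))
  ∧-affine g a b x y = begin
    (a ∨ (g ∧ b)) ∧ (x ∨ (g ∧ y))
      ≈⟨ ∧-distribʳ-∨ _ a (g ∧ b) ⟩
    (a ∧ (x ∨ (g ∧ y))) ∨ ((g ∧ b) ∧ (x ∨ (g ∧ y)))
      ≈⟨ ∨-cong constant linear ⟩
    ((a ∧ x) ∨ (g ∧ (a ∧ y))) ∨ (g ∧ (b ∧ (x ∨ y)))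
      ≈⟨ ∨-assoc _ _ _ ⟩
    (a ∧ x) ∨ ((g ∧ (a ∧ y)) ∨ (g ∧ (b ∧ (x ∨ y))))
      ≈⟨ ∨-congˡ (∧-distribˡ-∨ g _ _) ⟨
    (a ∧ x) ∨ (g ∧ ((a ∧ y) ∨ (b ∧ (x ∨ y)))) ∎
    where
    constant : a ∧ (x ∨ (g ∧ y)) ≈ (a ∧ x) ∨ (g ∧ (a ∧ y))
    constant = trans (∧-distribˡ-∨ a x _) (∨-congˡ (∧-CS.x∙yz≈y∙xz a g y))

    linear : (g ∧ b) ∧ (x ∨ (g ∧ y)) ≈ g ∧ (b ∧ (x ∨ y))
    linear = begin
      (g ∧ b) ∧ (x ∨ (g ∧ y))        ≈⟨ ∧-congʳ (∧-comm g b) ⟩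
      (b ∧ g) ∧ (x ∨ (g ∧ y))        ≈⟨ ∧-assoc b g _ ⟩
      b ∧ (g ∧ (x ∨ (g ∧ y)))        ≈⟨ ∧-congˡ (∧-distribˡ-∨ g x _) ⟩
      b ∧ ((g ∧ x) ∨ (g ∧ (g ∧ y)))  ≈⟨ ∧-congˡ (∨-congˡ (∧-assoc g g y)) ⟨
      b ∧ ((g ∧ x) ∨ ((g ∧ g) ∧ y))  ≈⟨ ∧-congˡ (∨-congˡ (∧-congʳ (∧-idem g))) ⟩
      b ∧ ((g ∧ x) ∨ (g ∧ y))        ≈⟨ ∧-congˡ (∧-distribˡ-∨ g x y) ⟨
      b ∧ (g ∧ (x ∨ y))              ≈⟨ ∧-CS.x∙yz≈y∙xz b g _ ⟩
      g ∧ (b ∧ (x ∨ y))              ∎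

  module Bounded {⊤ ⊥ : Carrier} (maximum : Maximum _≤_ ⊤) (minimum : Minimum _≤_ ⊥) where

    -- Complement is not a constructor, so the same type serves for sublattices of `L` and, when
    -- complements are listed among the generators, for Boolean subalgebras.
    data ⟨_⟩ (G : List Carrier) : Carrier → Set (c ⊔ ℓ) where
      gen  : ∀ {x} → x ∈ G → ⟨ G ⟩ x
      ⊤-cl : ⟨ G ⟩ ⊤
      ⊥-cl : ⟨ G ⟩ ⊥
      ∧-cl : ∀ {x y} → ⟨ G ⟩ x → ⟨ G ⟩ y → ⟨ G ⟩ (x ∧ y)
      ∨-cl : ∀ {x y} → ⟨ G ⟩ x → ⟨ G ⟩ y → ⟨ G ⟩ (x ∨ y)
      resp : ∀ {x y} → x ≈ y → ⟨ G ⟩ x → ⟨ G ⟩ y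

    -- Each generator contributes a pair of coefficients free of it, so the length is squared each
    -- time; repetitions are harmless.
    enumerate : List Carrier → List Carrier
    enumerate []      = ⊤ ∷ ⊥ ∷ []
    enumerate (g ∷ G) = cartesianProductWith (λ a b → a ∨ (g ∧ b)) (enumerate G) (enumerate G)

    ⟨[]⟩-bounds : ∀ {x} → ⟨ [] ⟩ x → x ≈ ⊤ ⊎ x ≈ ⊥
    ⟨[]⟩-bounds ⊤-cl = inj₁ refl
    ⟨[]⟩-bounds ⊥-cl = inj₂ refl
    ⟨[]⟩-bounds (∧-cl p q) with ⟨[]⟩-bounds p | ⟨[]⟩-bounds q
    ... | inj₁ x≈⊤ | inj₁ y≈⊤ = inj₁ (trans (∧-cong x≈⊤ y≈⊤) (∧-idem ⊤))
    ... | inj₁ x≈⊤ | inj₂ y≈⊥ = inj₂ (trans (∧-cong x≈⊤ y≈⊥) (trans (∧-comm ⊤ ⊥) (sym (minimum ⊤))))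
    ... | inj₂ x≈⊥ | _        = inj₂ (trans (∧-congʳ x≈⊥) (sym (minimum _)))
    ⟨[]⟩-bounds (∨-cl p q) with ⟨[]⟩-bounds p | ⟨[]⟩-bounds q
    ... | inj₁ x≈⊤ | _        = inj₁ (trans (∨-congʳ x≈⊤) (antisym (maximum _) (x≤x∨y ⊤ _)))
    ... | inj₂ x≈⊥ | inj₁ y≈⊤ = inj₁ (trans (∨-cong x≈⊥ y≈⊤)
                                  (trans (∨-comm ⊥ ⊤) (antisym (maximum _) (x≤x∨y ⊤ ⊥))))
    ... | inj₂ x≈⊥ | inj₂ y≈⊥ = inj₂ (trans (∨-cong x≈⊥ y≈⊥)
                                  (antisym (∨-least (minimum ⊥) (minimum ⊥)) (minimum _)))
    ⟨[]⟩-bounds (resp x≈y p) with ⟨[]⟩-bounds p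
    ... | inj₁ x≈⊤ = inj₁ (trans (sym x≈y) x≈⊤)
    ... | inj₂ x≈⊥ = inj₂ (trans (sym x≈y) x≈⊥)

    -- Affine forms in `g` contain the bounds and all generators, and are closed under both
    -- operations by `∨-affine` and `∧-affine`. This eliminates one generator at a time.
    affine-form : ∀ {g G x} → ⟨ g ∷ G ⟩ x →
                  ∃[ a ] ∃[ b ] ⟨ G ⟩ a × ⟨ G ⟩ b × x ≈ a ∨ (g ∧ b)
    affine-form {g} {G} = λ where
        (gen (here ≡.refl)) → ⊥ , ⊤ , ⊥-cl , ⊤-cl ,
          trans (maximum g) (antisym (y≤⊥∨y _) (∨-least (minimum _) (sym (∧-idem _))))
        (gen (there x∈G)) → constant (gen x∈G)
        ⊤-cl → constant ⊤-cl
        ⊥-cl → constant ⊥-cl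
        (∧-cl p q) →
          let (a , b , Ga , Gb , x≈) = affine-form p
              (a′ , b′ , Ga′ , Gb′ , y≈) = affine-form q
          in _ , _ , ∧-cl Ga Ga′ , ∨-cl (∧-cl Ga Gb′) (∧-cl Gb (∨-cl Ga′ Gb′)) ,
             trans (∧-cong x≈ y≈) (∧-affine g a b a′ b′)
        (∨-cl p q) →
          let (a , b , Ga , Gb , x≈) = affine-form p
              (a′ , b′ , Ga′ , Gb′ , y≈) = affine-form q
          in _ , _ , ∨-cl Ga Ga′ , ∨-cl Gb Gb′ ,
             trans (∨-cong x≈ y≈) (∨-affine g a b a′ b′)
        (resp x≈y p) →
          let (a , b , Ga , Gb , x≈) = affine-form p in a , b , Ga , Gb , trans (sym x≈y) x≈
      where
      y≤⊥∨y : ∀ y → y ≤ ⊥ ∨ y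
      y≤⊥∨y y = sym (trans (∧-congˡ (∨-comm ⊥ y)) (∧-absorbs-∨ y ⊥))

      constant : ∀ {x} → ⟨ G ⟩ x → ∃[ a ] ∃[ b ] ⟨ G ⟩ a × ⟨ G ⟩ b × x ≈ a ∨ (g ∧ b)
      constant {x} Gx = x , ⊥ , Gx , ⊥-cl , (begin
        x              ≈⟨ antisym (x≤x∨y x ⊥) (∨-least (sym (∧-idem x)) (minimum x)) ⟩
        x ∨ ⊥          ≈⟨ ∨-congˡ (minimum g) ⟩
        x ∨ (⊥ ∧ g)    ≈⟨ ∨-congˡ (∧-comm ⊥ g) ⟩
        x ∨ (g ∧ ⊥)    ∎)

    enumerate-complete : ∀ G {x} → ⟨ G ⟩ x → x ∈ₛ enumerate G
    enumerate-complete [] Gx with ⟨[]⟩-bounds Gx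
    ... | inj₁ x≈⊤ = here x≈⊤
    ... | inj₂ x≈⊥ = there (here x≈⊥)
    enumerate-complete (g ∷ G) Gx =
      let (a , b , Ga , Gb , x≈) = affine-form Gx in
      SetoidMembershipₚ.∈-resp-≈ setoid (sym x≈)
        (SetoidMembershipₚ.∈-cartesianProductWith⁺ setoid setoid setoid
          (λ p q → ∨-cong p (∧-congˡ q))
          (enumerate-complete G Ga) (enumerate-complete G Gb))

-- Generated Boolean subalgebras and finite partitions.

module BooleanSubalgebra (B : BooleanAlgebra c ℓ) where
  open BooleanAlgebra B
  open BooleanAlgebraProperties B
  open Order.Lattice (LatticeProperties.∨-∧-orderTheoreticLattice lattice)
    using (_≤_; antisym; x∧y≤x; x∧y≤y; ∧-greatest; x≤x∨y; y≤x∨y; ∨-least)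
    renaming (trans to ≤-trans; reflexive to ≤-reflexive)
  open ≈-Reasoning setoid

  maximum : Maximum _≤_ ⊤
  maximum x = sym (∧-identityʳ x)

  minimum : Minimum _≤_ ⊥
  minimum x = sym (∧-zeroˡ x)

  open BoundedSublattice.Bounded distributiveLattice maximum minimum public

  -- De Morgan's laws push a complement down to the generators.
  ¬-closed : ∀ {G} → (∀ {x} → x ∈ G → ⟨ G ⟩ (¬ x)) → ∀ {x} → ⟨ G ⟩ x → ⟨ G ⟩ (¬ x)
  ¬-closed ¬G (gen x∈G)    = ¬G x∈G
  ¬-closed ¬G ⊤-cl         = resp (sym ¬⊤≈⊥) ⊥-cl
  ¬-closed ¬G ⊥-cl         = resp (sym ¬⊥≈⊤) ⊤-cl
  ¬-closed ¬G (∧-cl p q)   = resp (sym (deMorgan₁ _ _)) (∨-cl (¬-closed ¬G p) (¬-closed ¬G q))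
  ¬-closed ¬G (∨-cl p q)   = resp (sym (deMorgan₂ _ _)) (∧-cl (¬-closed ¬G p) (¬-closed ¬G q))
  ¬-closed ¬G (resp x≈y p) = resp (¬-cong x≈y) (¬-closed ¬G p)

  ++-map-¬-closed : ∀ G {x} → ⟨ G ++ map ¬_ G ⟩ x → ⟨ G ++ map ¬_ G ⟩ (¬ x)
  ++-map-¬-closed G = ¬-closed λ x∈ → case (∈-++⁻ G x∈)
    where
    case : ∀ {x} → x ∈ G ⊎ x ∈ map ¬_ G → ⟨ G ++ map ¬_ G ⟩ (¬ x)
    case (inj₁ x∈G)  = gen (∈-++⁺ʳ G (∈-map⁺ ¬_ x∈G))
    case (inj₂ x∈¬G) with y , y∈G , ≡.refl ← ∈-map⁻ ¬_ x∈¬G =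
      resp (sym (¬-involutive y)) (gen (∈-++⁺ˡ y∈G))

  ≤⊥⇒≈⊥ : ∀ {x} → x ≤ ⊥ → x ≈ ⊥
  ≤⊥⇒≈⊥ x≤⊥ = antisym x≤⊥ (minimum _)

  ∧-split : ∀ a b → a ≈ (a ∧ b) ∨ (a ∧ ¬ b)
  ∧-split a b = begin
    a                      ≈⟨ ∧-identityʳ a ⟨
    a ∧ ⊤                  ≈⟨ ∧-congˡ (∨-complementʳ b) ⟨
    a ∧ (b ∨ ¬ b)          ≈⟨ ∧-distribˡ-∨ a b (¬ b) ⟩
    (a ∧ b) ∨ (a ∧ ¬ b)    ∎

  disjoint⇒≤¬ : ∀ {x y} → x ∧ y ≈ ⊥ → x ≤ ¬ y
  disjoint⇒≤¬ {x} {y} x∧y≈⊥ = begin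
    x                      ≈⟨ ∧-split x y ⟩
    (x ∧ y) ∨ (x ∧ ¬ y)    ≈⟨ ∨-congʳ x∧y≈⊥ ⟩
    ⊥ ∨ (x ∧ ¬ y)          ≈⟨ ∨-identityˡ _ ⟩
    x ∧ ¬ y                ∎

  below-complements : ∀ {x y z} → x ≤ y → z ≤ ¬ y → x ∧ z ≈ ⊥
  below-complements {y = y} x≤y z≤¬y = ≤⊥⇒≈⊥ (≤-trans
    (∧-greatest (≤-trans (x∧y≤x _ _) x≤y) (≤-trans (x∧y≤y _ _) z≤¬y))
    (≤-reflexive (∧-complementʳ y)))

  ∧-mono-⊥ : ∀ {x y u v} → x ≤ u → y ≤ v → u ∧ v ≈ ⊥ → x ∧ y ≈ ⊥
  ∧-mono-⊥ x≤u y≤v u∧v≈⊥ = ≤⊥⇒≈⊥ (≤-trans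
    (∧-greatest (≤-trans (x∧y≤x _ _) x≤u) (≤-trans (x∧y≤y _ _) y≤v)) (≤-reflexive u∧v≈⊥))

  -- `¬ a ∧ p` is the complement of `a ∧ p` in the interval below `p`, hence determined by it.
  ∧-cancel-¬ : ∀ {a b p} → a ∧ p ≈ b ∧ p → ¬ a ∧ p ≈ ¬ b ∧ p
  ∧-cancel-¬ a∧p≈b∧p = antisym (half a∧p≈b∧p) (half (sym a∧p≈b∧p))
    where
    half : ∀ {a b p} → a ∧ p ≈ b ∧ p → ¬ a ∧ p ≤ ¬ b ∧ p
    half {a} {b} {p} a∧p≈b∧p = ∧-greatest (disjoint⇒≤¬ (begin
      (¬ a ∧ p) ∧ b    ≈⟨ ∧-assoc (¬ a) p b ⟩
      ¬ a ∧ (p ∧ b)    ≈⟨ ∧-congˡ (trans (∧-comm p b) (sym a∧p≈b∧p)) ⟩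
      ¬ a ∧ (a ∧ p)    ≈⟨ ∧-assoc (¬ a) a p ⟨
      (¬ a ∧ a) ∧ p    ≈⟨ ∧-congʳ (∧-complementˡ a) ⟩
      ⊥ ∧ p            ≈⟨ ∧-zeroˡ p ⟩
      ⊥                ∎)) (x∧y≤y _ _)

  ⋁ : List Carrier → Carrier
  ⋁ = foldr _∨_ ⊥

  -- Parts equal to `⊥` and repeated parts are allowed: with `≈` possibly undecidable they could not
  -- be filtered out.
  record IsPartition (P : List Carrier) : Set (c ⊔ ℓ) where
    field
      cover    : ⊤ ≤ ⋁ P
      disjoint : ∀ {x y} → x ∈ P → y ∈ P → x ≡ y ⊎ x ∧ y ≈ ⊥

  -- The cut may depend on the part: `const g` cuts all parts by one generator, while `τ` cuts each
  -- part by its own image.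
  split : (Carrier → Carrier) → List Carrier → List Carrier
  split f []       = []
  split f (a ∷ as) = a ∧ f a ∷ a ∧ ¬ f a ∷ split f as

  split-∈ : ∀ f P {x} → x ∈ split f P → ∃[ a ] a ∈ P × (x ≡ a ∧ f a ⊎ x ≡ a ∧ ¬ f a)
  split-∈ f (a ∷ as) (here x≡)          = a , here ≡.refl , inj₁ x≡
  split-∈ f (a ∷ as) (there (here x≡))  = a , here ≡.refl , inj₂ x≡
  split-∈ f (a ∷ as) (there (there x∈)) =
    let (b , b∈as , x≡) = split-∈ f as x∈ in b , there b∈as , x≡

  piece-≤ : ∀ {x a b} → x ≡ a ∧ b ⊎ x ≡ a ∧ ¬ b → x ≤ a
  piece-≤ (inj₁ ≡.refl) = x∧y≤x _ _
  piece-≤ (inj₂ ≡.refl) = x∧y≤x _ _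

  split-≤ : ∀ f P {x} → x ∈ split f P → ∃[ a ] a ∈ P × x ≤ a
  split-≤ f P x∈ = let (a , a∈P , x≡) = split-∈ f P x∈ in a , a∈P , piece-≤ x≡

  split-cover : ∀ f P → ⋁ P ≤ ⋁ (split f P)
  split-cover f []       = minimum ⊥
  split-cover f (a ∷ as) = ∨-least
    (≤-trans (≤-reflexive (∧-split a (f a))) (∨-least (x≤x∨y _ _) (≤-trans (x≤x∨y _ _) (y≤x∨y _ _))))
    (≤-trans (split-cover f as) (≤-trans (y≤x∨y _ _) (y≤x∨y _ _)))

  split-disjoint : ∀ f {P} → (∀ {x y} → x ∈ P → y ∈ P → x ≡ y ⊎ x ∧ y ≈ ⊥) →
                   ∀ {x y} → x ∈ split f P → y ∈ split f P → x ≡ y ⊎ x ∧ y ≈ ⊥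
  split-disjoint f {P} P-disjoint x∈ y∈ with split-∈ f P x∈ | split-∈ f P y∈
  ... | a , a∈P , x≡ | b , b∈P , y≡ with P-disjoint a∈P b∈P | x≡ | y≡
  ... | inj₂ a∧b≈⊥  | x≡          | y≡          = inj₂ (∧-mono-⊥ (piece-≤ x≡) (piece-≤ y≡) a∧b≈⊥)
  ... | inj₁ ≡.refl | inj₁ ≡.refl | inj₁ ≡.refl = inj₁ ≡.refl
  ... | inj₁ ≡.refl | inj₂ ≡.refl | inj₂ ≡.refl = inj₁ ≡.refl
  ... | inj₁ ≡.refl | inj₁ ≡.refl | inj₂ ≡.refl = inj₂ (below-complements (x∧y≤y _ _) (x∧y≤y _ _))
  ... | inj₁ ≡.refl | inj₂ ≡.refl | inj₁ ≡.refl =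
    inj₂ (trans (∧-comm _ _) (below-complements (x∧y≤y _ _) (x∧y≤y _ _)))

  split-partition : ∀ f {P} → IsPartition P → IsPartition (split f P)
  split-partition f {P} isPartition = record
    { cover    = ≤-trans cover (split-cover f P)
    ; disjoint = split-disjoint f disjoint
    }
    where open IsPartition isPartition

  minterms : List Carrier → List Carrier
  minterms []       = ⊤ ∷ []
  minterms (g ∷ gs) = split (const g) (minterms gs)

  minterms-partition : ∀ gs → IsPartition (minterms gs)
  minterms-partition []       = record
    { cover    = x≤x∨y ⊤ ⊥
    ; disjoint = λ where (here x≡⊤) (here y≡⊤) → inj₁ (≡.trans x≡⊤ (≡.sym y≡⊤))
    }
  minterms-partition (g ∷ gs) = split-partition (const g) (minterms-partition gs)

  Decides : Carrier → Carrier → Set ℓ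
  Decides a g = a ≤ g ⊎ a ≤ ¬ g

  decides-mono : ∀ {x a g} → x ≤ a → Decides a g → Decides x g
  decides-mono x≤a (inj₁ a≤g)  = inj₁ (≤-trans x≤a a≤g)
  decides-mono x≤a (inj₂ a≤¬g) = inj₂ (≤-trans x≤a a≤¬g)

  minterms-decide : ∀ gs {g a} → g ∈ gs → a ∈ minterms gs → Decides a g
  minterms-decide (g ∷ gs) (here ≡.refl) a∈ with split-∈ (const g) (minterms gs) a∈
  ... | _ , _ , inj₁ ≡.refl = inj₁ (x∧y≤y _ _)
  ... | _ , _ , inj₂ ≡.refl = inj₂ (x∧y≤y _ _)
  minterms-decide (g ∷ gs) (there h∈gs) a∈ =
    let (b , b∈ , a≤b) = split-≤ (const g) (minterms gs) a∈
    in decides-mono a≤b (minterms-decide gs h∈gs b∈)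

  -- Difference operators, central elements and sharp parts.

  record IsDifferenceOperator (τ : Op₁ Carrier) : Set (c ⊔ ℓ) where
    field
      τ-cong : Congruent₁ _≈_ τ
      τ-∨    : ∀ x y → τ (x ∨ y) ≈ τ x ∧ τ y
      τ-⊤    : τ ⊤ ≈ ⊥
      τ-sym  : ∀ {x y} → x ≤ τ y → y ≤ τ x
      -- Read `τ x` as "`x` fails at every successor" for a relation on points. Then `τ-sym`
      -- expresses symmetry, `τ-⊤` that every point has a successor, and `τ-none`, given these, that
      -- two steps lead back to the point or to one of its successors.
      τ-none : ∀ x → τ (¬ (¬ x ∧ τ x)) ≈ ¬ x ∧ τ x

  module _ {τ : Op₁ Carrier} (isDifferenceOperator : IsDifferenceOperator τ) where
    open IsDifferenceOperator isDifferenceOperator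

    τ-antitone : ∀ {x y} → x ≤ y → τ y ≤ τ x
    τ-antitone {x} {y} x≤y = ≤-trans
      (≤-reflexive (trans (τ-cong (antisym (y≤x∨y x y) (∨-least x≤y (sym (∧-idem y))))) (τ-∨ x y)))
      (x∧y≤x _ _)

    τ-⊥ : τ ⊥ ≈ ⊤
    τ-⊥ = antisym (maximum _) (τ-sym (minimum _))

    -- In the relational reading, these are the unions of connected components.
    Central : Carrier → Set ℓ
    Central z = τ z ≈ ¬ z

    central-resp : ∀ {x y} → x ≈ y → Central x → Central y
    central-resp x≈y τx≈¬x = trans (τ-cong (sym x≈y)) (trans τx≈¬x (¬-cong x≈y))

    -- `τ (¬ z)` is disjoint from `τ z`, that is from `¬ z`, because their meet is `τ ⊤`; the other
    -- inequality is `¬ z ≤ τ z` turned around by symmetry.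
    central-¬ : ∀ {z} → Central z → Central (¬ z)
    central-¬ {z} τz≈¬z = antisym
      (disjoint⇒≤¬ (begin
        τ (¬ z) ∧ ¬ z  ≈⟨ ∧-congˡ τz≈¬z ⟨
        τ (¬ z) ∧ τ z  ≈⟨ τ-∨ (¬ z) z ⟨
        τ (¬ z ∨ z)    ≈⟨ τ-cong (∨-complementˡ z) ⟩
        τ ⊤            ≈⟨ τ-⊤ ⟩
        ⊥              ∎))
      (τ-sym (≤-reflexive (trans (sym τz≈¬z) (τ-cong (sym (¬-involutive z))))))

    central-∨ : ∀ {a b} → Central a → Central b → Central (a ∨ b)
    central-∨ τa≈¬a τb≈¬b =
      trans (τ-∨ _ _) (trans (∧-cong τa≈¬a τb≈¬b) (sym (deMorgan₂ _ _)))

    central-⊤ : Central ⊤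
    central-⊤ = trans τ-⊤ (sym ¬⊤≈⊥)

    central-⊥ : Central ⊥
    central-⊥ = trans τ-⊥ (sym ¬⊥≈⊤)

    central-none : ∀ x → Central (¬ x ∧ τ x)
    central-none x = central-resp (¬-involutive _)
      (central-¬ (trans (τ-none x) (sym (¬-involutive _))))

    -- Only the part of `τ (z ∧ x)` inside `z` needs work. There `z` is `τ (¬ z)`, so the meet is
    -- `τ` of the join `¬ z ∨ (z ∧ x)`, which lies above `x`.
    τ-central-∧ : ∀ {z} x → Central z → τ (z ∧ x) ≈ ¬ z ∨ τ x
    τ-central-∧ {z} x τz≈¬z = antisym
      (≤-trans split-z (∨-least (x≤x∨y _ _) (≤-trans inside (y≤x∨y _ _))))
      (∨-least (≤-trans (≤-reflexive (sym τz≈¬z)) (τ-antitone (x∧y≤x z x)))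
               (τ-antitone (x∧y≤y z x)))
      where
      split-z : τ (z ∧ x) ≤ ¬ z ∨ (z ∧ τ (z ∧ x))
      split-z = ≤-trans (≤-reflexive (begin
        τ (z ∧ x)                    ≈⟨ ∧-identityˡ _ ⟨
        ⊤ ∧ τ (z ∧ x)                ≈⟨ ∧-congʳ (∨-complementˡ z) ⟨
        (¬ z ∨ z) ∧ τ (z ∧ x)        ≈⟨ ∧-distribʳ-∨ _ (¬ z) z ⟩
        (¬ z ∧ τ (z ∧ x)) ∨ (z ∧ τ (z ∧ x)) ∎))
        (∨-least (≤-trans (x∧y≤x _ _) (x≤x∨y _ _)) (y≤x∨y _ _))

      x≤ : x ≤ ¬ z ∨ (z ∧ x)
      x≤ = ≤-trans 
        (∧-greatest (≤-trans (maximum x) (≤-reflexive (sym (∨-complementˡ z)))) (y≤x∨y (¬ z) x))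
        (≤-reflexive (sym (∨-distribˡ-∧ (¬ z) z x)))

      inside : z ∧ τ (z ∧ x) ≤ τ x
      inside = ≤-trans (≤-reflexive (begin
        z ∧ τ (z ∧ x)          ≈⟨ ∧-congʳ (trans (central-¬ τz≈¬z) (¬-involutive z)) ⟨
        τ (¬ z) ∧ τ (z ∧ x)    ≈⟨ τ-∨ _ _ ⟨
        τ (¬ z ∨ (z ∧ x))      ∎)) (τ-antitone x≤)

    -- Either no point of `a` has a successor in `a`, or all have one. On `a`, then, `τ a` agrees
    -- with `⊤` or with `⊥`, which are central.
    Sharp : Carrier → Set ℓ
    Sharp a = a ≤ τ a ⊎ a ∧ τ a ≈ ⊥

    τ-part-sharp : ∀ a → Sharp (a ∧ τ a)
    τ-part-sharp a = inj₁ (≤-trans (x∧y≤y _ _) (τ-antitone (x∧y≤x _ _)))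

    -- By symmetry a ≤ τ (a ∧ τ a), and τ sends the join of both parts of a to τ a.
    ¬τ-part-sharp : ∀ a → Sharp (a ∧ ¬ τ a)
    ¬τ-part-sharp a = inj₂ (≤⊥⇒≈⊥ (≤-trans
      (∧-greatest (≤-trans both≤ (≤-reflexive joined)) (≤-trans (x∧y≤x _ _) (x∧y≤y _ _)))
      (≤-reflexive (∧-complementʳ (τ a)))))
      where
      joined : τ (a ∧ τ a) ∧ τ (a ∧ ¬ τ a) ≈ τ a
      joined = trans (sym (τ-∨ _ _)) (τ-cong (sym (∧-split a (τ a))))

      both≤ : (a ∧ ¬ τ a) ∧ τ (a ∧ ¬ τ a) ≤ τ (a ∧ τ a) ∧ τ (a ∧ ¬ τ a)
      both≤ = ∧-greatest
        (≤-trans (x∧y≤x _ _) (≤-trans (x∧y≤x _ _) (τ-sym (x∧y≤y a (τ a)))))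
        (x∧y≤y _ _)

    split-sharp : ∀ P {x} → x ∈ split τ P → Sharp x
    split-sharp P x∈ with split-∈ τ P x∈
    ... | a , _ , inj₁ ≡.refl = τ-part-sharp a
    ... | a , _ , inj₂ ≡.refl = ¬τ-part-sharp a

    -- The τ-closed Boolean subalgebra of a sharp partition.

    module _ {P : List Carrier} (isPartition : IsPartition P) (sharp : ∀ {x} → x ∈ P → Sharp x) where
      open IsPartition isPartition

      signedParts : List Carrier
      signedParts = (P ++ map τ P) ++ map ¬_ (P ++ map τ P)

      private
        M : Carrier → Set (c ⊔ ℓ)
        M = ⟨ signedParts ⟩

        M-¬ : ∀ {x} → M x → M (¬ x)
        M-¬ = ++-map-¬-closed (P ++ map τ P)

        M-part : ∀ {x} → x ∈ P → M x
        M-part x∈P = gen (∈-++⁺ˡ (∈-++⁺ˡ x∈P))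

        M-τ-part : ∀ {x} → x ∈ P → M (τ x)
        M-τ-part x∈P = gen (∈-++⁺ˡ (∈-++⁺ʳ P (∈-map⁺ τ x∈P)))

      -- The central `z` has to lie in `M` because `τ x` is later assembled from `¬ z` inside `M`.
      CentralOn : Carrier → Carrier → Set (c ⊔ ℓ)
      CentralOn p x = ∃[ z ] M z × Central z × x ∧ p ≈ z ∧ p

      module _ {p : Carrier} where

        above-centralOn : ∀ {x} → p ≤ x → CentralOn p x
        above-centralOn p≤x = ⊤ , ⊤-cl , central-⊤ ,
          trans (∧-comm _ _) (trans (sym p≤x) (sym (∧-identityˡ p)))

        disjoint-centralOn : ∀ {x} → x ∧ p ≈ ⊥ → CentralOn p x
        disjoint-centralOn x∧p≈⊥ = ⊥ , ⊥-cl , central-⊥ , trans x∧p≈⊥ (sym (∧-zeroˡ p))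

        ¬-centralOn : ∀ {x} → CentralOn p x → CentralOn p (¬ x)
        ¬-centralOn (z , Mz , Cz , eq) = ¬ z , M-¬ Mz , central-¬ Cz , ∧-cancel-¬ eq

        ∨-centralOn : ∀ {x y} → CentralOn p x → CentralOn p y → CentralOn p (x ∨ y)
        ∨-centralOn (z , Mz , Cz , eq) (w , Mw , Cw , eq′) = z ∨ w , ∨-cl Mz Mw , central-∨ Cz Cw ,
          trans (∧-distribʳ-∨ p _ _) (trans (∨-cong eq eq′) (sym (∧-distribʳ-∨ p z w)))

        resp-centralOn : ∀ {x y} → x ≈ y → CentralOn p x → CentralOn p y
        resp-centralOn x≈y (z , Mz , Cz , eq) = z , Mz , Cz , trans (∧-congʳ (sym x≈y)) eq

        ∧-centralOn : ∀ {x y} → CentralOn p x → CentralOn p y → CentralOn p (x ∧ y)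
        ∧-centralOn {x} {y} Cx Cy = resp-centralOn
          (trans (deMorgan₂ _ _) (∧-cong (¬-involutive x) (¬-involutive y)))
          (¬-centralOn (∨-centralOn (¬-centralOn Cx) (¬-centralOn Cy)))

        module _ (p∈P : p ∈ P) where

          part-centralOn : ∀ {x} → x ∈ P → CentralOn p x
          part-centralOn x∈P with disjoint x∈P p∈P
          ... | inj₁ ≡.refl = above-centralOn (≤-reflexive refl)
          ... | inj₂ x∧p≈⊥  = disjoint-centralOn x∧p≈⊥

          -- Off the part x, τ x agrees with the central element ¬ x ∧ τ x.
          τ-part-centralOn : ∀ {x} → x ∈ P → CentralOn p (τ x)
          τ-part-centralOn {x} x∈P with disjoint x∈P p∈P
          ... | inj₂ x∧p≈⊥ = ¬ x ∧ τ x , ∧-cl (M-¬ (M-part x∈P)) (M-τ-part x∈P) , central-none x ,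
            antisym (∧-greatest (∧-greatest p≤¬x (x∧y≤x _ _)) (x∧y≤y _ _))
                    (∧-greatest (≤-trans (x∧y≤x _ _) (x∧y≤y _ _)) (x∧y≤y _ _))
            where
            p≤¬x : τ x ∧ p ≤ ¬ x
            p≤¬x = ≤-trans (x∧y≤y _ _) (disjoint⇒≤¬ (trans (∧-comm p x) x∧p≈⊥))
          ... | inj₁ ≡.refl with sharp x∈P
          ...   | inj₁ x≤τx   = above-centralOn x≤τx
          ...   | inj₂ x∧τx≈⊥ = disjoint-centralOn (trans (∧-comm _ _) x∧τx≈⊥)

          generator-centralOn : ∀ {x} → x ∈ P ++ map τ P → CentralOn p x
          generator-centralOn x∈ with ∈-++⁻ P x∈
          ... | inj₁ x∈P  = part-centralOn x∈P
          ... | inj₂ x∈τP with y , y∈P , ≡.refl ← ∈-map⁻ τ x∈τP = τ-part-centralOn y∈P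

          centralOn-part : ∀ {x} → M x → CentralOn p x
          centralOn-part (gen x∈) with ∈-++⁻ (P ++ map τ P) x∈
          ... | inj₁ x∈G  = generator-centralOn x∈G
          ... | inj₂ x∈¬G with y , y∈G , ≡.refl ← ∈-map⁻ ¬_ x∈¬G =
            ¬-centralOn (generator-centralOn y∈G)
          centralOn-part ⊤-cl           = above-centralOn (maximum p)
          centralOn-part ⊥-cl           = disjoint-centralOn (∧-zeroˡ p)
          centralOn-part (∧-cl Mx My)   = ∧-centralOn (centralOn-part Mx) (centralOn-part My)
          centralOn-part (∨-cl Mx My)   = ∨-centralOn (centralOn-part Mx) (centralOn-part My)
          centralOn-part (resp x≈y Mx)  = resp-centralOn x≈y (centralOn-part Mx)

      ∧-cover : ∀ x → x ∧ ⋁ P ≈ x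
      ∧-cover x = antisym (x∧y≤x _ _) (∧-greatest (≤-reflexive refl) (≤-trans (maximum x) cover))

      -- Cutting `x` along the partition makes `τ x` the meet of the elements `¬ z ∨ τ p`, one for
      -- each part `p`.
      signedParts-τ-closed : ∀ {x} → M x → M (τ x)
      signedParts-τ-closed {x} Mx = resp (τ-cong (∧-cover x)) (go P (λ p∈P → p∈P))
        where
        -- The induction runs over sublists, with the inclusion carried along because `z` is
        -- available only for members of `P`. The empty join gives `τ ⊥`, which is `⊤`.
        go : ∀ Q → Q ⊆ P → M (τ (x ∧ ⋁ Q))
        go []      _   = resp (trans (sym τ-⊥) (τ-cong (sym (∧-zeroʳ x)))) ⊤-cl
        go (p ∷ Q) Q⊆P with z , Mz , Cz , eq ← centralOn-part (Q⊆P (here ≡.refl)) Mx =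
          resp (begin
            (¬ z ∨ τ p) ∧ τ (x ∧ ⋁ Q)    ≈⟨ ∧-congʳ (τ-central-∧ p Cz) ⟨
            τ (z ∧ p) ∧ τ (x ∧ ⋁ Q)      ≈⟨ ∧-congʳ (τ-cong eq) ⟨
            τ (x ∧ p) ∧ τ (x ∧ ⋁ Q)      ≈⟨ τ-∨ _ _ ⟨
            τ ((x ∧ p) ∨ (x ∧ ⋁ Q))      ≈⟨ τ-cong (∧-distribˡ-∨ x p (⋁ Q)) ⟨
            τ (x ∧ (p ∨ ⋁ Q))            ∎)
            (∧-cl (∨-cl (M-¬ Mz) (M-τ-part (Q⊆P (here ≡.refl)))) (go Q (Q⊆P ∘ there)))

      -- Every part lies below `x` or misses it, so `x` is the join of the parts below it.
      decided∈signedParts : ∀ {x} → (∀ {p} → p ∈ P → Decides p x) → M x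
      decided∈signedParts {x} decides = resp (∧-cover x) (go P (λ p∈P → p∈P))
        where
        piece : ∀ {p} → p ∈ P → M (x ∧ p)
        piece p∈P with decides p∈P
        ... | inj₁ p≤x  = resp (trans p≤x (∧-comm _ x)) (M-part p∈P)
        ... | inj₂ p≤¬x = resp (sym (below-complements (≤-reflexive refl) p≤¬x)) ⊥-cl

        go : ∀ Q → Q ⊆ P → M (x ∧ ⋁ Q)
        go []      _   = resp (sym (∧-zeroʳ x)) ⊥-cl
        go (p ∷ Q) Q⊆P = resp (sym (∧-distribˡ-∨ x p (⋁ Q)))
          (∨-cl (piece (Q⊆P (here ≡.refl))) (go Q (Q⊆P ∘ there)))

    -- The minterms decide every member of `gs`; cutting them by `τ` makes the parts sharp and
    -- preserves these decisions.
    τ-closed-extension : ∀ gs → ∃[ H ] (∀ {x} → x ∈ gs → ⟨ H ⟩ x) ×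
                         (∀ {x} → ⟨ H ⟩ x → ⟨ H ⟩ (¬ x)) × (∀ {x} → ⟨ H ⟩ x → ⟨ H ⟩ (τ x))
    τ-closed-extension gs =
        signedParts isPartition sharp
      , (λ g∈gs → decided∈signedParts isPartition sharp λ p∈P →
          let (a , a∈ , p≤a) = split-≤ τ (minterms gs) p∈P
          in decides-mono p≤a (minterms-decide gs g∈gs a∈))
      , ++-map-¬-closed (P ++ map τ P)
      , signedParts-τ-closed isPartition sharp
      where
      P : List Carrier
      P = split τ (minterms gs)

      isPartition : IsPartition P
      isPartition = split-partition τ (minterms-partition gs)

      sharp : ∀ {x} → x ∈ P → Sharp x
      sharp = split-sharp (minterms gs)

-- The Boolean skeleton of `L` and its difference operator.

module Skeleton (L : PseudocomplementedDeMorganAlgebra c ℓ) where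
  open PseudocomplementedDeMorganAlgebra L hiding (_≤_)
  open Order.Lattice (LatticeProperties.∨-∧-orderTheoreticLattice lattice)
    using (_≤_; antisym; x∧y≤x; x∧y≤y; ∧-greatest; x≤x∨y; y≤x∨y; ∨-least)
    renaming (trans to ≤-trans; reflexive to ≤-reflexive)
  open ≈-Reasoning setoid

  disjoint⇒≤* : ∀ {x y} → x ∧ y ≈ ⊥ → y ≤ x *
  disjoint⇒≤* = Equivalence.to (pseudocomplement _ _)

  ≤*⇒disjoint : ∀ {x y} → y ≤ x * → x ∧ y ≈ ⊥
  ≤*⇒disjoint = Equivalence.from (pseudocomplement _ _)

  ∧-*-≈⊥ : ∀ x → x ∧ x * ≈ ⊥
  ∧-*-≈⊥ x = ≤*⇒disjoint (≤-reflexive refl)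

  ≤⊥⇒≈⊥ : ∀ {x} → x ≤ ⊥ → x ≈ ⊥
  ≤⊥⇒≈⊥ x≤⊥ = antisym x≤⊥ (minimum _)

  *-antitone : ∀ {x y} → x ≤ y → y * ≤ x *
  *-antitone x≤y = disjoint⇒≤* (≤⊥⇒≈⊥ (≤-trans
    (∧-greatest (≤-trans (x∧y≤x _ _) x≤y) (x∧y≤y _ _)) (≤-reflexive (∧-*-≈⊥ _))))

  x≤x** : ∀ x → x ≤ x * *
  x≤x** x = disjoint⇒≤* (trans (∧-comm _ _) (∧-*-≈⊥ x))

  ***≈* : ∀ x → x * * * ≈ x *
  ***≈* x = antisym (*-antitone (x≤x** x)) (x≤x** (x *))

  ∨-* : ∀ x y → (x ∨ y) * ≈ x * ∧ y *
  ∨-* x y = antisym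
    (∧-greatest (*-antitone (x≤x∨y x y)) (*-antitone (y≤x∨y x y)))
    (disjoint⇒≤* (trans (∧-distribʳ-∨ _ x y) (≤⊥⇒≈⊥ (∨-least
      (≤-reflexive (≤*⇒disjoint (x∧y≤x _ _))) (≤-reflexive (≤*⇒disjoint (x∧y≤y _ _)))))))

  ⊤*≈⊥ : ⊤ * ≈ ⊥
  ⊤*≈⊥ = trans (trans (maximum _) (∧-comm _ _)) (∧-*-≈⊥ ⊤)

  -- `z ∧ (y ∧ z) *` is disjoint from `y`, so it lies below `y *`, hence below `x *`, and is
  -- disjoint from `x`. This makes meets well defined on the skeleton.
  *≤*⇒∧-*≤* : ∀ {x y} z → y * ≤ x * → (y ∧ z) * ≤ (x ∧ z) *
  *≤*⇒∧-*≤* {x} {y} z y*≤x* = disjoint⇒≤* (trans (∧-assoc _ _ _) (≤*⇒disjoint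
    (≤-trans (disjoint⇒≤* (trans (sym (∧-assoc _ _ _)) (∧-*-≈⊥ (y ∧ z)))) y*≤x*)))

  -- The conclusion is the order of the skeleton, unfolded; with the converse below it becomes an
  -- inequality in `L`.
  *≤*⇒*≈∧-* : ∀ {x y} → y * ≤ x * → x * ≈ (x ∧ y) *
  *≤*⇒*≈∧-* {x} {y} y*≤x* = antisym (*-antitone (x∧y≤x x y))
    (≤-trans (≤-trans (≤-reflexive (*-cong (∧-comm x y))) (*≤*⇒∧-*≤* x y*≤x*))
             (*-antitone (∧-greatest (≤-reflexive refl) (≤-reflexive refl))))

  *≈∧-*⇒*≤* : ∀ {x y} → x * ≈ (x ∧ y) * → y * ≤ x *
  *≈∧-*⇒*≤* {x} {y} eq = ≤-trans (*-antitone (x∧y≤y x y)) (≤-reflexive (sym eq))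

  ′-antitone : ∀ {x y} → x ≤ y → y ′ ≤ x ′
  ′-antitone {x} {y} x≤y = ≤-trans
    (≤-reflexive (trans (′-cong (antisym (y≤x∨y x y) (∨-least x≤y (≤-reflexive refl)))) (′-deMorgan x y)))
    (x∧y≤x _ _)

  ′-deMorgan-∧ : ∀ x y → (x ∧ y) ′ ≈ x ′ ∨ y ′
  ′-deMorgan-∧ x y = begin
    (x ∧ y) ′          ≈⟨ ′-cong (∧-cong (′-involutive x) (′-involutive y)) ⟨
    (x ′ ′ ∧ y ′ ′) ′  ≈⟨ ′-cong (′-deMorgan _ _) ⟨
    (x ′ ∨ y ′) ′ ′    ≈⟨ ′-involutive _ ⟩
    x ′ ∨ y ′          ∎

  ⊥′≈⊤ : ⊥ ′ ≈ ⊤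
  ⊥′≈⊤ = antisym (maximum _)
    (≤-trans (≤-reflexive (sym (′-involutive ⊤))) (′-antitone (minimum (⊤ ′))))

  ⊤′≈⊥ : ⊤ ′ ≈ ⊥
  ⊤′≈⊥ = trans (′-cong (sym ⊥′≈⊤)) (′-involutive ⊥)

  -- By Glivenko's theorem, identifying x and y when x * ≈ y * gives a Boolean
  -- algebra, with the operations of L and complement *.
  skeleton : BooleanAlgebra c ℓ
  skeleton = record
    { Carrier = Carrier
    ; _≈_     = λ x y → x * ≈ y *
    ; _∨_     = _∨_
    ; _∧_     = _∧_
    ; ¬_      = _*
    ; ⊤       = ⊤
    ; ⊥       = ⊥
    ; isBooleanAlgebra = isBooleanAlgebraʳ record
      { isDistributiveLattice = record
        { isLattice = record
          { isEquivalence = record { refl = refl ; sym = sym ; trans = trans }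
          ; ∨-comm        = λ x y → *-cong (∨-comm x y)
          ; ∨-assoc       = λ x y z → *-cong (∨-assoc x y z)
          ; ∨-cong        = λ p q → trans (∨-* _ _) (trans (∧-cong p q) (sym (∨-* _ _)))
          ; ∧-comm        = λ x y → *-cong (∧-comm x y)
          ; ∧-assoc       = λ x y z → *-cong (∧-assoc x y z)
          ; ∧-cong        = λ p q → trans (∧-*-congʳ p)
              (trans (*-cong (∧-comm _ _)) (trans (∧-*-congʳ q) (*-cong (∧-comm _ _))))
          ; absorptive    = (λ x y → *-cong (∨-absorbs-∧ x y)) , (λ x y → *-cong (∧-absorbs-∨ x y))
          }
        ; ∨-distrib-∧ = (λ x y z → *-cong (∨-distribˡ-∧ x y z)) , (λ x y z → *-cong (∨-distribʳ-∧ x y z))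
        ; ∧-distrib-∨ = (λ x y z → *-cong (∧-distribˡ-∨ x y z)) , (λ x y z → *-cong (∧-distribʳ-∨ x y z))
        }
      ; ∨-complementʳ = λ x → trans (∨-* x (x *)) (trans (∧-*-≈⊥ (x *)) (sym ⊤*≈⊥))
      ; ∧-complementʳ = λ x → *-cong (∧-*-≈⊥ x)
      ; ¬-cong        = *-cong
      }
    }
    where
    ∧-*-congʳ : ∀ {x y z} → x * ≈ y * → (x ∧ z) * ≈ (y ∧ z) *
    ∧-*-congʳ {z = z} eq = antisym (*≤*⇒∧-*≤* z (≤-reflexive eq)) (*≤*⇒∧-*≤* z (≤-reflexive (sym eq)))

  -- Depending only on `x *`, this is well defined on the skeleton, whereas `′` alone need not be.
  τ : Carrier → Carrier
  τ x = x * ′ *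

  open BooleanSubalgebra skeleton using (IsDifferenceOperator)

  -- The identity of range one at x ′, since (x ′ ∧ x ′ ′ *) ′ * ≈ x * ∧ τ x.
  none-′*-fixed : RangeOne L → ∀ x → (x * ∧ τ x) ′ * ≈ x * ∧ τ x
  none-′*-fixed rangeOne x = begin
    (x * ∧ τ x) ′ *                    ≈⟨ *-cong (′-cong rewritten) ⟨
    (x ′ ∧ x ′ ′ *) ′ * ′ *            ≈⟨ rangeOne (x ′) ⟨
    (x ′ ∧ x ′ ′ *) ′ *                ≈⟨ rewritten ⟩
    x * ∧ τ x                          ∎
    where
    rewritten : (x ′ ∧ x ′ ′ *) ′ * ≈ x * ∧ τ x
    rewritten = begin
      (x ′ ∧ x ′ ′ *) ′ *    ≈⟨ *-cong (′-cong (∧-congˡ (*-cong (′-involutive x)))) ⟩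
      (x ′ ∧ x *) ′ *        ≈⟨ *-cong (′-deMorgan-∧ _ _) ⟩
      (x ′ ′ ∨ x * ′) *      ≈⟨ *-cong (∨-congʳ (′-involutive x)) ⟩
      (x ∨ x * ′) *          ≈⟨ ∨-* x (x * ′) ⟩
      x * ∧ τ x              ∎

  isDifferenceOperator : RangeOne L → IsDifferenceOperator τ
  isDifferenceOperator rangeOne = record
    { τ-cong = λ eq → *-cong (*-cong (′-cong eq))
    ; τ-∨    = λ x y → *-cong (begin
        (x ∨ y) * ′ *        ≈⟨ *-cong (′-cong (∨-* x y)) ⟩
        (x * ∧ y *) ′ *      ≈⟨ *-cong (′-deMorgan-∧ _ _) ⟩
        (x * ′ ∨ y * ′) *    ≈⟨ ∨-* _ _ ⟩
        τ x ∧ τ y            ∎)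
    ; τ-⊤    = *-cong (begin
        ⊤ * ′ *    ≈⟨ *-cong (′-cong ⊤*≈⊥) ⟩
        ⊥ ′ *      ≈⟨ *-cong ⊥′≈⊤ ⟩
        ⊤ *        ≈⟨ ⊤*≈⊥ ⟩
        ⊥          ∎)
    -- The hypothesis gives `y * ′ ≤ x *`. Applying `′` yields `x * ′ ≤ y *`, and two further
    -- pseudocomplements turn this into `τ x * ≤ y *`.
    ; τ-sym  = λ {x} {y} x≤τy → *≤*⇒*≈∧-* (≤-trans
        (*-antitone (*-antitone (≤-trans
          (′-antitone (≤-trans (x≤x** (y * ′)) (*≈∧-*⇒*≤* x≤τy)))
          (≤-reflexive (′-involutive (y *))))))
        (≤-reflexive (***≈* y)))
    -- `x * ∧ τ x` is itself a pseudocomplement, that of `x ∨ x * ′`, so the double `*` on it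
    -- cancels.
    ; τ-none = λ x → *-cong (begin
        (x * ∧ τ x) * * ′ *            ≈⟨ *-cong (′-cong (*-cong (*-cong (∨-* x (x * ′))))) ⟨
        (x ∨ x * ′) * * * ′ *          ≈⟨ *-cong (′-cong (***≈* _)) ⟩
        (x ∨ x * ′) * ′ *              ≈⟨ *-cong (′-cong (∨-* x (x * ′))) ⟩
        (x * ∧ τ x) ′ *                ≈⟨ none-′*-fixed rangeOne x ⟩
        x * ∧ τ x                      ∎)
    }

-- From the skeleton back to `L`.

module _ (L : PseudocomplementedDeMorganAlgebra c ℓ) (rangeOne : RangeOne L) where
  open PseudocomplementedDeMorganAlgebra L
  open Skeleton L using (τ; skeleton; isDifferenceOperator; ***≈*; ⊤′≈⊥; ⊥′≈⊤; ′-deMorgan-∧)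
  private
    module B = BooleanSubalgebra skeleton
    module D = BoundedSublattice.Bounded distributiveLattice maximum minimum

  rangeOne-locallyFinite : FinitelyGenerated L → Finite L
  rangeOne-locallyFinite (n , g , generated) =
      D.enumerate latticeGenerators
    , λ x → D.enumerate-complete latticeGenerators (proj₁ (proj₁ (tame (generated x))))
    where
    generators : List Carrier
    generators = tabulate g ++ map _′ (tabulate g)

    extension = B.τ-closed-extension (isDifferenceOperator rangeOne) generators
    H = proj₁ extension

    M : Carrier → Set _
    M = B.⟨ H ⟩

    M-gen : ∀ {x} → x ∈ generators → M x
    M-gen = proj₁ (proj₂ extension)

    M-* : ∀ {x} → M x → M (x *)
    M-* = proj₁ (proj₂ (proj₂ extension))

    M-τ : ∀ {x} → M x → M (τ x)
    M-τ = proj₂ (proj₂ (proj₂ extension))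

    -- `B.enumerate H` exhausts `M` only up to equality of pseudocomplements. Applying `*` turns
    -- this into a list of all `x *` with `x` in `M`, up to `≈` in `L`.
    skeletal : List Carrier
    skeletal = map _* (B.enumerate H)

    latticeGenerators : List Carrier
    latticeGenerators = generators ++ (skeletal ++ map _′ skeletal)

    S : Carrier → Set _
    S = D.⟨ latticeGenerators ⟩

    ∈-skeletal : ∀ {x} → M x → ∃[ y ] y ∈ skeletal × x * ≈ y
    ∈-skeletal Mx =
      let (m , m∈ , x*≈m*) = find (B.enumerate-complete H Mx)
      in m * , ∈-map⁺ _* m∈ , x*≈m*

    S-* : ∀ {x} → M x → S (x *)
    S-* Mx = let (y , y∈ , x*≈y) = ∈-skeletal Mx in
      D.resp (sym x*≈y) (D.gen (∈-++⁺ʳ generators (∈-++⁺ˡ y∈)))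

    S-*′ : ∀ {x} → M x → S (x * ′)
    S-*′ Mx = let (y , y∈ , x*≈y) = ∈-skeletal Mx in
      D.resp (′-cong (sym x*≈y)) (D.gen (∈-++⁺ʳ generators (∈-++⁺ʳ skeletal (∈-map⁺ _′ y∈))))

    -- `S` is the finiteness wanted; `M` keeps the induction going, since `S-*` obtains `x *` from
    -- `M x` and not from `S x`.
    Tame : Carrier → Set _
    Tame x = S x × M x

    tame-resp : ∀ {x y} → x ≈ y → Tame x → Tame y
    tame-resp x≈y (Sx , Mx) = D.resp x≈y Sx , B.resp (*-cong x≈y) Mx

    tame-gen : ∀ {x} → x ∈ generators → Tame x
    tame-gen x∈ = D.gen (∈-++⁺ˡ x∈) , M-gen x∈

    tame-∧ : ∀ {x y} → Tame x → Tame y → Tame (x ∧ y)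
    tame-∧ (Sx , Mx) (Sy , My) = D.∧-cl Sx Sy , B.∧-cl Mx My

    tame-∨ : ∀ {x y} → Tame x → Tame y → Tame (x ∨ y)
    tame-∨ (Sx , Mx) (Sy , My) = D.∨-cl Sx Sy , B.∨-cl Mx My

    -- In the skeleton `x * ′` equals its double complement `τ x *`.
    M-*′ : ∀ {x} → M x → M (x * ′)
    M-*′ {x} Mx = B.resp (***≈* (x * ′)) (M-* (M-τ Mx))

    -- `x ′` is treated together with `x` because `′` does not act on the skeleton: De Morgan's laws
    -- move it inwards until it meets a generator, a bound or a pseudocomplement.
    tame : ∀ {x} → Generated L g x → Tame x × Tame (x ′)
    tame (gen i)      = tame-gen (∈-++⁺ˡ (∈-tabulate⁺ i)) ,
                        tame-gen (∈-++⁺ʳ (tabulate g) (∈-map⁺ _′ (∈-tabulate⁺ i)))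
    tame ⊤-cl         = (D.⊤-cl , B.⊤-cl) , tame-resp (sym ⊤′≈⊥) (D.⊥-cl , B.⊥-cl)
    tame ⊥-cl         = (D.⊥-cl , B.⊥-cl) , tame-resp (sym ⊥′≈⊤) (D.⊤-cl , B.⊤-cl)
    tame (∧-cl p q)   = let (x , x′) = tame p ; (y , y′) = tame q in
                        tame-∧ x y , tame-resp (sym (′-deMorgan-∧ _ _)) (tame-∨ x′ y′)
    tame (∨-cl p q)   = let (x , x′) = tame p ; (y , y′) = tame q in
                        tame-∨ x y , tame-resp (sym (′-deMorgan _ _)) (tame-∧ x′ y′)
    tame (*-cl p)     = let ((_ , Mx) , _) = tame p in (S-* Mx , M-* Mx) , (S-*′ Mx , M-*′ Mx)
    tame (′-cl p)     = let (x , x′) = tame p in x′ , tame-resp (sym (′-involutive _)) x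
    tame (resp x≈y p) = let (x , x′) = tame p in tame-resp x≈y x , tame-resp (′-cong x≈y) x′

theorem4p10 : (c ℓ : Level) → LocallyFinite (M₁ {c} {ℓ})
theorem4p10 c ℓ L m₁ = rangeOne-locallyFinite L (M₁.rangeOne m₁)
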